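{- Let $n \ge 4$ be an integer, let $\Gamma$ be a nontrivial finite group, and let $M$ be a lift of the cycle matroid $M(K_n^{\Gamma})$ such that a cycle of $K_n^{\Gamma}$ is a circuit of $M$ if and only if it is balanced. If $r(M) - r(M(K_n^{\Gamma})) > 1$, then there are a prime $p$ and an integer $j \ge 2$ such that $\Gamma \cong \mathbb{Z}_p^j$.
   Context: For a finite group $\Gamma$ with identity $\epsilon$ and integer $n$, $K_n^{\Gamma}$ is the graph with vertex set $[n]$ and edge set $\binom{[n]}{2}\times\Gamma$; the edge $(\{i,j\},\alpha)$ with $i<j$ is oriented from $i$ to $j$ and labeled $\alpha$. A cycle (including a $2$-edge cycle of two parallel edges) is balanced if, traversing it cyclically and multiplying the labels, using $\alpha$ for an edge traversed along its orientation and $\alpha^{ -1}$ for one traversed against it, the product is $\epsilon$. $M(K_n^\Gamma)$ is the cycle matroid of $K_n^\Gamma$. Given matroids $M, L$ on a common ground set $E$, $L$ is a lift of $M$ if there is a matroid $K$ on $E\cup F$ with $M=K/F$ and $L=K\setminus F$. $r(\cdot)$ denotes the rank of a matroid; $\mathbb{Z}_p^j$ is the direct sum of $j$ copies of the cyclic group of order $p$. -}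

module Defs where

open import Level using (0ℓ)
open import Data.Nat as ℕ using (ℕ; zero; suc; _+_; _≤_)
open import Data.Nat.DivMod using (_mod_)
open import Data.Fin as Fin using (Fin; toℕ; _≟_)
open import Data.Vec using (Vec; zipWith)
open import Data.List using (List; length; tabulate; foldr)
open import Data.List.Membership.Propositional using (_∈_)
open import Data.List.Relation.Unary.Unique.Propositional using (Unique)
open import Data.Product using (Σ; ∃; ∃-syntax; _×_; _,_)
open import Data.Sum using (_⊎_; inj₁; inj₂; [_,_])
open import Data.Empty using (⊥)
open import Data.Bool using (if_then_else_)
open import Relation.Nullary using (¬_; ⌊_⌋)
open import Relation.Unary using (Pred; _⊆_; _∪_; U)
open import Relation.Binary.PropositionalEquality using (_≡_; _≢_)
open import Function using (_⇔_)
open import Function.Definitions using (Bijective)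
open import Algebra.Structures using (IsGroup)

-- Finite groups.  A finite group is presented with carrier Fin m and
-- propositional equality (every finite group is isomorphic to one).

record FinGroup : Set where
  field
    m       : ℕ
    _∙_     : Fin m → Fin m → Fin m
    ε       : Fin m
    _⁻¹     : Fin m → Fin m
    isGroup : IsGroup _≡_ _∙_ ε _⁻¹

addMod : {p : ℕ} → Fin p → Fin p → Fin p
addMod {suc p} a b = (toℕ a + toℕ b) mod (suc p)

_⊕_ : {p j : ℕ} → Vec (Fin p) j → Vec (Fin p) j → Vec (Fin p) j
_⊕_ = zipWith addMod

_≅Zp^_ : FinGroup → ℕ → ℕ → Set
(Γ ≅Zp^ p) j = Σ (Fin m → Vec (Fin p) j) λ f → (Bijective _≡_ _≡_ f ×
                      (∀ x y → f (x ∙ y) ≡ f x ⊕ f y))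
  where open FinGroup Γ

HasCard : {E : Set} → Pred E 0ℓ → ℕ → Set
HasCard {E} X k = ∃[ l ] (Unique l × (∀ e → (X e ⇔ e ∈ l)) × length l ≡ k)

record Matroid (E : Set) : Set₁ where
  field
    Indep   : Pred E 0ℓ → Set
    indep-∅ : Indep (λ _ → ⊥)
    indep-⊆ : ∀ {X Y} → X ⊆ Y → Indep Y → Indep X
    augment : ∀ {I J a b} → Indep I → Indep J → HasCard I a → HasCard J b →
              a ℕ.< b →
              ∃[ Z ] (I ⊆ Z × Z ⊆ (I ∪ J) × HasCard Z (suc a) × Indep Z)

open Matroid public

IsRank : {E : Set} → Matroid E → Pred E 0ℓ → ℕ → Set₁
IsRank M X r =
  (∃[ I ] (I ⊆ X × Indep M I × HasCard I r)) ×
  (∀ I s → I ⊆ X → Indep M I → HasCard I s → s ≤ r)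

IsRankOf : {E : Set} → Matroid E → ℕ → Set₁
IsRankOf M r = IsRank M U r

Circuit : {E : Set} → Matroid E → Pred E 0ℓ → Set₁
Circuit M C = ¬ Indep M C × (∀ D → D ⊆ C → ¬ (C ⊆ D) → Indep M D)

IsBasis : {E : Set} → Matroid E → Pred E 0ℓ → Pred E 0ℓ → Set₁
IsBasis M S B =
  B ⊆ S × Indep M B × (∀ B' → B ⊆ B' → B' ⊆ S → Indep M B' → B' ⊆ B)

inl-set : {E F : Set} → Pred E 0ℓ → Pred (E ⊎ F) 0ℓ
inl-set X = [ X , (λ _ → ⊥) ]

inr-set : {E F : Set} → Pred F 0ℓ → Pred (E ⊎ F) 0ℓ
inr-set Y = [ (λ _ → ⊥) , Y ]

DelIndep : {E F : Set} → Matroid (E ⊎ F) → Pred E 0ℓ → Set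
DelIndep K X = Indep K (inl-set X)

-- Independent sets of the contraction K / F: X ∪ B independent in K,
-- B a basis of F in K (independent of the choice of B).
ConIndep : {E F : Set} → Matroid (E ⊎ F) → Pred E 0ℓ → Set₁
ConIndep K X = ∃[ B ] (IsBasis K (inr-set U) B × Indep K (inl-set X ∪ B))

IsLift : {E : Set} → Matroid E → Matroid E → Set₁
IsLift {E} L M = ∃[ k ] ∃[ K ] (
  (∀ X → (ConIndep {E} {Fin k} K X ⇔ Indep M X)) ×
  (∀ X → (DelIndep {E} {Fin k} K X ⇔ Indep L X)))

-- Edge ({i,j}, α) with i < j, oriented from i to j, labelled α.
record Edge (n m : ℕ) : Set where
  constructor edge
  field
    i   : Fin n
    j   : Fin n
    i<j : i Fin.< j
    lab : Fin m

next : {k : ℕ} → Fin (suc (suc k)) → Fin (suc (suc k))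
next {k} t = suc (toℕ t) mod (suc (suc k))

-- A cycle of length 2 + len (≥ 2; length 2 means two parallel edges):
-- distinct vertices vs 0, …, vs (L-1), distinct edges, es t joins
-- vs t and vs (t+1 mod L).
record Cycle (n m : ℕ) : Set where
  field
    len    : ℕ
    vs     : Fin (suc (suc len)) → Fin n
    es     : Fin (suc (suc len)) → Edge n m
    vs-inj : ∀ s t → vs s ≡ vs t → s ≡ t
    es-inj : ∀ s t → es s ≡ es t → s ≡ t
    joins  : ∀ t → (Edge.i (es t) ≡ vs t × Edge.j (es t) ≡ vs (next t)) ⊎
                   (Edge.i (es t) ≡ vs (next t) × Edge.j (es t) ≡ vs t)

CycleSet : {n m : ℕ} → Cycle n m → Pred (Edge n m) 0ℓ
CycleSet C e = ∃[ t ] (Cycle.es C t ≡ e)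
  where open Cycle

module _ (Γ : FinGroup) where
  open FinGroup Γ

  -- product of labels along the cycle: α if traversed along its
  -- orientation (from vs t to vs (t+1)), α⁻¹ otherwise.
  Balanced : {n : ℕ} → Cycle n m → Set
  Balanced C = foldr _∙_ ε (tabulate step) ≡ ε
    where
      open Cycle C
      step : Fin (suc (suc len)) → Fin m
      step t = if ⌊ Edge.i (es t) ≟ vs t ⌋
               then Edge.lab (es t) else (Edge.lab (es t)) ⁻¹

  CycleIndep : (n : ℕ) → Pred (Edge n m) 0ℓ → Set
  CycleIndep n X = ∀ (C : Cycle n m) → ¬ (CycleSet C ⊆ X)

  IsCycleMatroid : (n : ℕ) → Matroid (Edge n m) → Set₁
  IsCycleMatroid n N = ∀ X → (Indep N X ⇔ CycleIndep n X)

{-# OPTIONS --safe #-}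
-- On the parallel class of edges between two fixed vertices, M induces a matroid
-- on Γ.  An edge with an endpoint not met by l raises the rank of l, and balanced
-- triangles transport spans between parallel classes, so the line through ε and
-- α ≠ ε is the same in every class and is a subgroup.  Along a path of three
-- edges its copy in the last class is a conjugate, while the span of the two end
-- classes does not see the middle edge; hence the lines are normal.  They meet in
-- ε only and, since the rank of M exceeds that of M(K_n^Γ) by more than one, they
-- are proper.  A group partitioned into proper normal subgroups is elementary
-- abelian: elements on different lines commute, and (xy)^k = y^k for x^k = ε
-- shows that torsion spreads from one line to all others.
--
-- Independence in M is not decidable, so closure is a negative statement and the
-- matroid arguments run under ¬¬ until they reach decidable facts about Γ.
module Submission where

open import Defs
open import Data.Nat using (ℕ; _≤_; _<_; _+_)
open import Data.Nat.Primality using (Prime)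
open import Data.Fin using (Fin)
open import Data.Product using (∃; ∃-syntax; _×_)
open import Relation.Binary.PropositionalEquality using (_≢_)
open import Function using (_⇔_)

open import Algebra.Bundles using (Group; CommutativeMonoid)
open import Algebra.Structures using (IsGroup)
open import Data.Bool using (if_then_else_)
open import Data.Empty using (⊥; ⊥-elim)
open import Data.Fin using (zero; suc; toℕ; fromℕ; inject₁)
open import Data.List using (List; []; _∷_; _++_; length; map; filter; allFin)
open import Data.List.Membership.Propositional using (_∈_; _∉_; find; lose)
open import Data.List.Membership.Propositional.Properties using (∈-filter⁺; ∈-filter⁻; ∈-map⁺; ∈-map⁻; ∈-++⁺ˡ; ∈-++⁺ʳ; ∈-++⁻; ∈-allFin)
open import Data.List.Properties using (filter-notAll; length-map; length-++; length-tabulate)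
open import Data.List.Relation.Unary.All using (All; []; _∷_)
open import Data.List.Relation.Unary.All.Properties using (¬Any⇒All¬)
open import Data.List.Relation.Unary.AllPairs using ([]; _∷_)
open import Data.List.Relation.Unary.Any using (here; there; any?)
open import Data.List.Relation.Unary.Unique.Propositional using (Unique)
open import Data.Nat using (zero; suc; z≤n; s≤s; _≤?_; _∸_; _*_; nonTrivial⇒n>1)
open import Data.Nat.Coprimality using (prime⇒coprime; coprime-Bézout)
open import Data.Nat.DivMod using (m<n⇒m%n≡m; n%n≡0; _%_; m%n<n; _/_; m≡m%n+[m/n]*n)
open import Data.Nat.GCD using (module Bézout)
open import Data.Nat.ListAction using (product)
open import Data.Nat.Primality using (¬prime[0]; prime⇒nonTrivial)
open import Data.Nat.Primality.Factorisation using (factorise; PrimeFactorisation)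
open import Data.Product using (_,_; proj₁; proj₂)
open import Data.Sum using (_⊎_; inj₁; inj₂)
open import Data.Sum.Properties using (inj₁-injective; inj₂-injective; ≡-dec)
open import Data.Vec using (Vec; []; _∷_)
open import Function using (mk⇔; id; _∘_; Equivalence)
open import Function.Definitions using (Injective)
open import Level using (0ℓ)
open import Relation.Binary using (DecidableEquality; tri<; tri≈; tri>)
open import Relation.Nullary using (¬_; Dec; yes; no; ¬?; Stable; contradiction; ⌊_⌋)
open import Relation.Nullary.Decidable using (decidable-stable; ¬¬-excluded-middle; map′)
open import Relation.Unary using (_⊆_; Decidable)
open import Relation.Binary.PropositionalEquality hiding (_≢_)
import Data.Nat.Properties as ℕ
import Data.Fin.Properties as Fin
import Data.List.Membership.DecPropositional as DecMembership
open import Data.List.Relation.Binary.Subset.Propositional.Properties using (∈-∷⁺ʳ; ∷⁺ʳ)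
open import Data.List.Relation.Binary.Subset.Propositional using () renaming (_⊆_ to _⊆ₗ_)
import Data.List.Relation.Unary.Any as Any
import Data.List.Relation.Unary.All as All
import Data.List.Relation.Unary.Unique.Propositional.Properties as Unique
import Data.Fin as Fin
import Algebra.Properties.Group as GroupProperties
import Algebra.Properties.Monoid.Mult as MonoidMult
import Algebra.Properties.CommutativeMonoid.Mult as CommutativeMonoidMult
import Algebra.Properties.CommutativeSemigroup as CommutativeSemigroupProperties
open Equivalence using (to; from)

-- Lists without repetition

private variable
  A : Set

unique-∷ : {x : A} {xs : List A} → x ∉ xs → Unique xs → Unique (x ∷ xs)
unique-∷ x∉ u = ¬Any⇒All¬ _ x∉ ∷ u

-- Removing the head of `xs` from `ys` by filtering makes `ys` strictly shorter, and uniqueness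
-- keeps the tail of `xs` inside what remains.
length-⊆ : {xs ys : List A} → DecidableEquality A → Unique xs → xs ⊆ₗ ys → length xs ≤ length ys
length-⊆ {xs = []} _≟_ _ _ = z≤n
length-⊆ {xs = x ∷ xs} {ys = ys} _≟_ (x≢ ∷ u) s = ℕ.≤-<-trans
  (length-⊆ _≟_ u λ y∈ → ∈-filter⁺ P? (s (there y∈)) (All.lookup x≢ y∈))
  (filter-notAll P? ys (Any.map (λ eq ne → ne eq) (s (here refl))))
  where P? = λ y → ¬? (x ≟ y)

∃-outside : {xs ys : List A} → DecidableEquality A → Unique xs → length ys < length xs →
            ∃ λ x → x ∈ xs × x ∉ ys
∃-outside {xs = xs} {ys = ys} _≟_ u lt
  with any? (λ x → ¬? (x ∈? ys)) xs
  where open DecMembership _≟_ using (_∈?_)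
... | yes p = find p
... | no ¬p = contradiction
  (length-⊆ _≟_ u λ {x} x∈ → decidable-stable (x ∈? ys) λ x∉ → ¬p (lose x∈ x∉))
  (ℕ.<⇒≱ lt)
  where open DecMembership _≟_ using (_∈?_)

-- Span in a matroid

module Span {E : Set} (_≟_ : DecidableEquality E) (M : Matroid E) where

  open DecMembership _≟_ using (_∈?_)

  I : List E → Set
  I l = Indep M (_∈ l)

  Ind : List E → Set
  Ind l = Unique l × I l

  -- The closure of an independent list, phrased negatively so that it is stable.
  Cl : List E → E → Set
  Cl l e = I (e ∷ l) → e ∈ l

  I-⊆ : ∀ {l l'} → l ⊆ₗ l' → I l' → I l
  I-⊆ s = indep-⊆ M s

  Cl-stable : ∀ {l e} → Stable (Cl l e)
  Cl-stable {l} {e} ¬¬c i = decidable-stable (e ∈? l) λ e∉ → ¬¬c λ c → e∉ (c i)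

  Cl-∈ : ∀ {l e} → e ∈ l → Cl l e
  Cl-∈ e∈ _ = e∈

  Cl-mono : ∀ {l l' e} → l ⊆ₗ l' → Cl l e → Cl l' e
  Cl-mono s c i = s (c (I-⊆ (∷⁺ʳ _ s) i))

  hasCard : {l : List E} → Unique l → HasCard (_∈ l) (length l)
  hasCard {l} u = l , u , (λ _ → mk⇔ id id) , refl

  augment-list : ∀ {l l'} → Ind l → Ind l' → length l < length l' →
                 ∃ λ z → l ⊆ₗ z × z ⊆ₗ (l ++ l') × length z ≡ suc (length l) × Ind z
  augment-list {l} {l'} (u , i) (u' , i') lt
    with Z , l⊆Z , Z⊆ , (z , uz , Z⇔z , len) , iZ ← augment M i i' (hasCard u) (hasCard u') lt
    = z , (λ {e} e∈ → to (Z⇔z e) (l⊆Z e∈)) , (λ {e} e∈ → z⊆ (Z⊆ (from (Z⇔z e) e∈)))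
    , len , uz , indep-⊆ M (λ {e} → from (Z⇔z e)) iZ
    where
    z⊆ : ∀ {e} → e ∈ l ⊎ e ∈ l' → e ∈ (l ++ l')
    z⊆ (inj₁ e∈l)  = ∈-++⁺ˡ e∈l
    z⊆ (inj₂ e∈l') = ∈-++⁺ʳ l e∈l'

  -- If `l'` were longer, augmentation would add to `l` an element of `l'` outside `l`, which `Cl l`
  -- forbids.
  span-length : ∀ {l l'} → Ind l → Ind l' → (∀ {e} → e ∈ l' → Cl l e) → length l' ≤ length l
  span-length {l} {l'} il il' c with length l' ≤? length l
  ... | yes le = le
  ... | no nle
    with z , l⊆z , z⊆ , len , uz , iz ← augment-list il il' (ℕ.≰⇒> nle)
    with e , e∈z , e∉l ← ∃-outside {ys = l} _≟_ uz (ℕ.≤-reflexive (sym len))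
    with ∈-++⁻ l (z⊆ e∈z)
  ...   | inj₁ e∈l  = contradiction e∈l e∉l
  ...   | inj₂ e∈l' = contradiction (c e∈l' (I-⊆ (∈-∷⁺ʳ e∈z l⊆z) iz)) e∉l

  -- Augmentation is iterated; `k` counts the elements still missing and makes the recursion
  -- structural.
  extend : ∀ k {l l'} → Ind l → Ind l' → length l' ≡ k + length l →
           ∃ λ z → l ⊆ₗ z × z ⊆ₗ (l ++ l') × length z ≡ length l' × Ind z
  extend zero {l} il il' eq = l , id , ∈-++⁺ˡ , sym eq , il
  extend (suc k) {l} {l'} il il' eq
    with z , l⊆z , z⊆ , len , iz ← augment-list il il'
           (subst (length l <_) (sym eq) (s≤s (ℕ.m≤n+m (length l) k)))
    with w , z⊆w , w⊆ , lenw , iw ← extend k iz il'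
           (trans eq (trans (sym (ℕ.+-suc k _)) (cong (k +_) (sym len))))
    = w , z⊆w ∘ l⊆z , w⊆' , lenw , iw
    where
    w⊆' : w ⊆ₗ (l ++ l')
    w⊆' e∈ with ∈-++⁻ z (w⊆ e∈)
    ... | inj₁ e∈z  = z⊆ e∈z
    ... | inj₂ e∈l' = ∈-++⁺ʳ l e∈l'

  -- If `g ∷ l` were independent and longer than `l`, `c` could be enlarged from it to length one
  -- more than `l`. The element `g` is never added, because `g ∷ c` is dependent, so the result lies
  -- in the closure of `l`, against `span-length`.
  Cl-trans : ∀ {l c g} → Ind l → Ind c → (∀ {e} → e ∈ c → Cl l e) → ¬ I (g ∷ c) → Cl l g
  Cl-trans {l} {c} {g} il ic c⊆ ¬igc igl with g ∈? l
  ... | yes g∈ = g∈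
  ... | no g∉
    with z , c⊆z , z⊆ , len , uz , iz ← extend (suc (length l) ∸ length c) {l' = g ∷ l} ic
           (unique-∷ g∉ (proj₁ il) , igl)
           -- `span-length` bounds `c` by `l`, so the truncated subtraction is exact.
           (sym (ℕ.m∸n+n≡m (ℕ.m≤n⇒m≤1+n (span-length il ic c⊆))))
    = contradiction (span-length il (uz , iz) z⊆Cl) (ℕ.<⇒≱ (ℕ.≤-reflexive (sym len)))
    where
    z⊆Cl : ∀ {e} → e ∈ z → Cl l e
    z⊆Cl e∈ with ∈-++⁻ c (z⊆ e∈)
    ... | inj₁ e∈c           = c⊆ e∈c
    ... | inj₂ (here refl)   = contradiction (I-⊆ (∈-∷⁺ʳ e∈ c⊆z) iz) ¬igc
    ... | inj₂ (there e∈l)   = Cl-∈ e∈l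

  -- The greedy choice of a basis; each step asks whether a list is independent, hence the double
  -- negation.
  basis : ∀ l → ¬ ¬ (∃ λ c → Ind c × c ⊆ₗ l × (∀ {e} → e ∈ l → Cl c e))
  basis []      k = k ([] , ([] , indep-⊆ M (λ ()) (indep-∅ M)) , id , λ ())
  basis (f ∷ l) k = basis l λ (c , ic , c⊆ , sp) →
    let keep = λ clf → k (c , ic , there ∘ c⊆ , λ { (here refl) → clf ; (there e∈) → sp e∈ })
    in ¬¬-excluded-middle λ where
      (no ¬i) → keep (λ i → contradiction i ¬i)
      (yes i) → case-∈ c ic c⊆ sp i keep (f ∈? c)
    where
    case-∈ : ∀ c → Ind c → c ⊆ₗ l → (∀ {e} → e ∈ l → Cl c e) → I (f ∷ c) →
             (Cl c f → ⊥) → Dec (f ∈ c) → ⊥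
    case-∈ c ic c⊆ sp i keep (yes f∈) = keep (Cl-∈ f∈)
    case-∈ c ic c⊆ sp i keep (no f∉)  =
      k (f ∷ c , (unique-∷ f∉ (proj₁ ic) , i) , ∷⁺ʳ _ c⊆
        , λ { (here refl) → Cl-∈ (here refl) ; (there e∈) → Cl-mono there (sp e∈) })

-- Matroid lifts

¬¬-decidable : ∀ {k} (P : Fin k → Set) → ¬ ¬ (∀ i → Dec (P i))
¬¬-decidable {zero}  P ¬d = ¬d λ ()
¬¬-decidable {suc k} P ¬d = ¬¬-excluded-middle λ d₀ → ¬¬-decidable (P ∘ suc) λ d →
  ¬d λ { zero → d₀ ; (suc i) → d i }

module Lift {E : Set} (_≟_ : DecidableEquality E) (L M : Matroid E) where

  private
    module SM = Span _≟_ M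
    module SL = Span _≟_ L

  -- A set independent in the contraction is independent in `K` together with a basis of the
  -- contracted set, hence also alone.
  lift-indep : IsLift L M → ∀ {X} → Indep M X → Indep L X
  lift-indep (k , K , con , del) {X} i
    with B , _ , iB ← from (con X) i
    = to (del X) (indep-⊆ K (λ { {inj₁ _} x → inj₁ x ; {inj₂ _} ()}) iB)

  -- In K, a basis of the contracted set together with c spans l but not e.
  lift-extend : IsLift L M → ∀ {l c e} → SL.Ind l → SM.I (e ∷ c) → Unique c → e ∉ c →
                (∀ {f} → f ∈ l → SM.Cl c f) → ¬ ¬ SL.I (e ∷ l)
  lift-extend (k , K , con , del) {l} {c} {e} (ul , il) iec uc e∉c sp ¬iel
    with B , isB , iB ← from (con (_∈ (e ∷ c))) iec
    -- `B` is an arbitrary predicate. Its restriction to the finitely many contracted elements is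
    -- decidable under double negation, which suffices for a negative goal and lets `b` enumerate
    -- it.
    = ¬¬-decidable (λ i → B (inj₂ i)) contra
    where
    module SK = Span (≡-dec _≟_ Fin._≟_) K
    contra : (∀ i → Dec (B (inj₂ i))) → ⊥
    contra B? = contradiction (∈-++⁻ (map inj₁ c) inK) λ where
        (inj₁ p) → case-map (∈-map⁻ inj₁ p)
        (inj₂ p) → case-inj₂ (∈-map⁻ inj₂ p)
      where
      b = map inj₂ (filter B? (allFin k))
      lK = map inj₁ c ++ b

      case-map : ¬ (∃ λ y → y ∈ c × inj₁ e ≡ inj₁ y)
      case-map (_ , y∈ , refl) = e∉c y∈
      case-inj₂ : ¬ (∃ λ y → y ∈ filter B? (allFin k) × inj₁ e ≡ inj₂ y)
      case-inj₂ ()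

      b⇒B : ∀ {x} → x ∈ b → B x
      b⇒B x∈ with ∈-map⁻ inj₂ x∈
      ... | y , y∈ , refl = proj₂ (∈-filter⁻ B? {xs = allFin k} y∈)

      lK⊆ : ∀ {g x} → x ∈ (inj₁ g ∷ lK) → (inl-set (_∈ (g ∷ c)) x) ⊎ B x
      lK⊆ (here refl) = inj₁ (here refl)
      lK⊆ (there x∈) with ∈-++⁻ (map inj₁ c) x∈
      ... | inj₂ x∈b = inj₂ (b⇒B x∈b)
      ... | inj₁ x∈c with ∈-map⁻ inj₁ x∈c
      ...   | y , y∈ , refl = inj₁ (there y∈)

      iK : SK.I (inj₁ e ∷ lK)
      iK = indep-⊆ K lK⊆ iB

      uK : Unique lK
      uK = Unique.++⁺ (Unique.map⁺ inj₁-injective uc)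
             (Unique.map⁺ inj₂-injective (Unique.filter⁺ B? (Unique.allFin⁺ k)))
             λ (p , q) → disjoint (∈-map⁻ inj₁ p) (∈-map⁻ inj₂ q)
        where
        disjoint : ∀ {x} → (∃ λ y → y ∈ c × x ≡ inj₁ y) →
                   ¬ (∃ λ y → y ∈ filter B? (allFin k) × x ≡ inj₂ y)
        disjoint (_ , _ , refl) (_ , _ , ())

      K-indep : ∀ {ls} → SL.I ls → SK.I (map inj₁ ls)
      K-indep {ls} i = indep-⊆ K sub (from (del (_∈ ls)) i)
        where
        sub : ∀ {x} → x ∈ map inj₁ ls → inl-set (_∈ ls) x
        sub x∈ with ∈-map⁻ inj₁ x∈
        ... | _ , y∈ , refl = y∈

      -- Independence of `f`, `c` and `B` in `K` is independence of `f ∷ c` in the contraction,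
      -- where `c` spans `f`.
      spanK : ∀ {x} → x ∈ map inj₁ l → SK.Cl lK x
      spanK x∈ i with ∈-map⁻ inj₁ x∈
      ... | f , f∈ , refl = ∈-++⁺ˡ (∈-map⁺ inj₁ (sp f∈ (to (con (_∈ (f ∷ c)))
              (B , isB , indep-⊆ K full i))))
        where
        full : ∀ {x} → inl-set (_∈ (f ∷ c)) x ⊎ B x → x ∈ (inj₁ f ∷ lK)
        full {inj₁ y} (inj₁ (here refl)) = here refl
        full {inj₁ y} (inj₁ (there y∈)) = there (∈-++⁺ˡ (∈-map⁺ inj₁ y∈))
        full {inj₁ y} (inj₂ By) = ⊥-elim (proj₁ isB By)
        full {inj₂ y} (inj₂ By) =
          there (∈-++⁺ʳ (map inj₁ c) (∈-map⁺ inj₂ (∈-filter⁺ B? (∈-allFin y) By)))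

      -- If `e ∷ l` is dependent, `e` lies in the closure of `l` in `K`, hence in that of `lK`. As
      -- `e` together with `lK` is independent, `e` would have to be a member of `lK`.
      inK : inj₁ e ∈ lK
      inK = SK.Cl-trans (uK , SK.I-⊆ there iK)
              (Unique.map⁺ inj₁-injective ul , K-indep il) spanK
              (λ i → ¬iel (to (del (_∈ (e ∷ l))) (indep-⊆ K sub i))) iK
        where
        sub : ∀ {x} → inl-set (_∈ (e ∷ l)) x → x ∈ (map inj₁ (e ∷ l))
        sub {inj₁ y} y∈ = ∈-map⁺ inj₁ y∈

-- Cycles of K_n^Γ

edge-≡ : ∀ {n m} {e f : Edge n m} → Edge.i e ≡ Edge.i f → Edge.j e ≡ Edge.j f →
         Edge.lab e ≡ Edge.lab f → e ≡ f
edge-≡ {e = edge i j p x} {edge _ _ q _} refl refl refl =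
  cong (λ r → edge i j r x) (ℕ.≤-irrelevant p q)

_≟ᴱ_ : ∀ {n m} → DecidableEquality (Edge n m)
e ≟ᴱ f with Edge.i e Fin.≟ Edge.i f | Edge.j e Fin.≟ Edge.j f | Edge.lab e Fin.≟ Edge.lab f
... | yes p | yes q | yes r = yes (edge-≡ p q r)
... | no ¬p | _     | _     = no (¬p ∘ cong Edge.i)
... | yes _ | no ¬q | _     = no (¬q ∘ cong Edge.j)
... | yes _ | yes _ | no ¬r = no (¬r ∘ cong Edge.lab)

next-inject₁ : ∀ {k} (t : Fin (suc k)) → next (inject₁ t) ≡ suc t
next-inject₁ {k} t = Fin.toℕ-injective (begin
  toℕ (next (inject₁ t))               ≡⟨ Fin.toℕ-fromℕ< (m%n<n (suc (toℕ (inject₁ t))) (suc (suc k))) ⟩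
  suc (toℕ (inject₁ t)) % suc (suc k)  ≡⟨ cong (λ a → suc a % suc (suc k)) (Fin.toℕ-inject₁ t) ⟩
  suc (toℕ t) % suc (suc k)            ≡⟨ m<n⇒m%n≡m (s≤s (Fin.toℕ<n t)) ⟩
  suc (toℕ t)                          ∎)
  where open ≡-Reasoning

next-fromℕ : ∀ k → next (fromℕ (suc k)) ≡ zero
next-fromℕ k = Fin.toℕ-injective (begin
  toℕ (next (fromℕ (suc k)))                  ≡⟨ Fin.toℕ-fromℕ< (m%n<n (suc (toℕ (fromℕ (suc k)))) (suc (suc k))) ⟩
  suc (toℕ (fromℕ (suc k))) % suc (suc k)     ≡⟨ cong (λ a → suc a % suc (suc k)) (Fin.toℕ-fromℕ (suc k)) ⟩
  suc (suc k) % suc (suc k)                   ≡⟨ n%n≡0 (suc (suc k)) ⟩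
  0                                           ∎)
  where open ≡-Reasoning

-- The cyclic predecessor differs from `t` because the length is at least 2; it yields the second
-- edge at a visited vertex.
prev : ∀ {k} (t : Fin (suc (suc k))) → ∃ λ s → next s ≡ t × s ≢ t
prev {k} zero = fromℕ (suc k) , next-fromℕ k , λ ()
prev (suc t)  = inject₁ t , next-inject₁ t , λ eq → ℕ.1+n≢n (sym (trans (sym (Fin.toℕ-inject₁ t)) (cong toℕ eq)))

module _ {n m : ℕ} where

  Incident : Fin n → Edge n m → Set
  Incident v e = Edge.i e ≡ v ⊎ Edge.j e ≡ v

  module _ (C : Cycle n m) where
    open Cycle C

    incident⇒visited : ∀ {v} t → Incident v (es t) → ∃ λ u → vs u ≡ v
    incident⇒visited t inc with joins t | inc
    ... | inj₁ (p , q) | inj₁ r = t      , trans (sym p) r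
    ... | inj₁ (p , q) | inj₂ r = next t , trans (sym q) r
    ... | inj₂ (p , q) | inj₁ r = next t , trans (sym p) r
    ... | inj₂ (p , q) | inj₂ r = t      , trans (sym q) r

    visited⇒two-edges : ∀ {v} u → vs u ≡ v →
      ∃ λ s → ∃ λ t → s ≢ t × Incident v (es s) × Incident v (es t)
    visited⇒two-edges u eq with s , ns≡u , s≢u ← prev u = s , u , s≢u , atₛ (joins s) , atᵤ (joins u)
      where
      atₛ : _ → _
      atₛ (inj₁ (_ , q)) = inj₂ (trans q (trans (cong vs ns≡u) eq))
      atₛ (inj₂ (p , _)) = inj₁ (trans p (trans (cong vs ns≡u) eq))
      atᵤ : _ → _
      atᵤ (inj₁ (p , _)) = inj₁ (trans p eq)
      atᵤ (inj₂ (_ , q)) = inj₂ (trans q eq)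

group : FinGroup → Group 0ℓ 0ℓ
group Γ = record { isGroup = FinGroup.isGroup Γ }

module _ (Γ : FinGroup) (n : ℕ) where
  open FinGroup Γ

  -- A cycle through a leaf would need a second edge there.
  leaf-acyclic : ∀ {c v e} → CycleIndep Γ n (_∈ c) → (∀ {f} → f ∈ c → ¬ Incident v f) →
                 Incident v e → CycleIndep Γ n (_∈ (e ∷ c))
  leaf-acyclic {c} {v} {e} ic v∉c v∈e C C⊆ with Fin.any? (λ t → Cycle.es C t ≟ᴱ e)
  ... | yes (t , refl)
    with u , eq ← incident⇒visited C t v∈e
    with s , s' , s≢s' , vs , vs' ← visited⇒two-edges C u eq
    = s≢s' (Cycle.es-inj C s s' (trans (only vs (C⊆ (s , refl))) (sym (only vs' (C⊆ (s' , refl))))))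
    where
    only : ∀ {f} → Incident v f → f ∈ (Cycle.es C t ∷ c) → f ≡ Cycle.es C t
    only inc (here eq)  = eq
    only inc (there f∈) = contradiction inc (v∉c f∈)
  ... | no ¬t = ic C λ { (t , refl) → skip t (C⊆ (t , refl)) }
    where
    skip : ∀ t → Cycle.es C t ∈ (e ∷ c) → Cycle.es C t ∈ c
    skip t (here eq)  = contradiction (t , eq) ¬t
    skip t (there f∈) = f∈

  -- Digons and balanced triangles

  module _ {i j : Fin n} (i<j : i Fin.< j) {x y : Fin m} (x≢y : x ≢ y) where

    digon : Cycle n m
    digon = record
      { len = 0
      ; vs = λ { zero → i ; (suc zero) → j }
      ; es = λ { zero → edge i j i<j x ; (suc zero) → edge i j i<j y }
      ; vs-inj = λ { zero zero _ → refl ; zero (suc zero) eq → contradiction eq i≢j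
                   ; (suc zero) zero eq → contradiction (sym eq) i≢j ; (suc zero) (suc zero) _ → refl }
      ; es-inj = λ { zero zero _ → refl ; zero (suc zero) eq → contradiction (cong Edge.lab eq) x≢y
                   ; (suc zero) zero eq → contradiction (sym (cong Edge.lab eq)) x≢y
                   ; (suc zero) (suc zero) _ → refl }
      ; joins = λ { zero → inj₁ (refl , refl) ; (suc zero) → inj₂ (refl , refl) }
      }
      where
      i≢j : i ≢ j
      i≢j = Fin.<⇒≢ i<j

    digon-pair : ∀ {e} → CycleSet digon e → e ≡ edge i j i<j x ⊎ e ≡ edge i j i<j y
    digon-pair (zero , eq)     = inj₁ (sym eq)
    digon-pair (suc zero , eq) = inj₂ (sym eq)

    -- A cycle has two distinct edges, so one inside the digon uses both of its edges, and `D` is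
    -- then the whole digon.
    digon-subset-acyclic : ∀ D → D ⊆ CycleSet digon → ¬ (CycleSet digon ⊆ D) → CycleIndep Γ n D
    digon-subset-acyclic D D⊆ ¬⊆D C C⊆ =
      both (digon-pair (D⊆ (C⊆ (zero , refl)))) (digon-pair (D⊆ (C⊆ (suc zero , refl))))
      where
      open Cycle C
      es₀≢es₁ : es zero ≢ es (suc zero)
      es₀≢es₁ eq with () ← es-inj _ _ eq

      in-D : ∀ {t u} → es t ≡ edge i j i<j x → es u ≡ edge i j i<j y → CycleSet digon ⊆ D
      in-D {t} {u} p q (zero , refl)     = C⊆ (t , p)
      in-D {t} {u} p q (suc zero , refl) = C⊆ (u , q)

      both : es zero ≡ edge i j i<j x ⊎ es zero ≡ edge i j i<j y →
             es (suc zero) ≡ edge i j i<j x ⊎ es (suc zero) ≡ edge i j i<j y → ⊥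
      both (inj₁ p) (inj₁ q) = es₀≢es₁ (trans p (sym q))
      both (inj₂ p) (inj₂ q) = es₀≢es₁ (trans p (sym q))
      both (inj₁ p) (inj₂ q) = ¬⊆D (in-D p q)
      both (inj₂ p) (inj₁ q) = ¬⊆D (in-D q p)

  -- With `if-≢`, this evaluates the orientation test in `Balanced`.
  if-≡ : ∀ {A : Set} {v w : Fin n} {a b : A} → v ≡ w → (if ⌊ v Fin.≟ w ⌋ then a else b) ≡ a
  if-≡ {v = v} {w} eq with v Fin.≟ w
  ... | yes _ = refl
  ... | no ¬p = contradiction eq ¬p

  if-≢ : ∀ {A : Set} {v w : Fin n} {a b : A} → v ≢ w → (if ⌊ v Fin.≟ w ⌋ then a else b) ≡ b
  if-≢ {v = v} {w} ne with v Fin.≟ w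
  ... | yes p = contradiction p ne
  ... | no _  = refl

  open IsGroup isGroup using (assoc; identityʳ; inverseʳ)

  -- The second edge is traversed against its orientation, so the product is `x ∙ (y ⁻¹)`.
  digon-unbalanced : ∀ {i j : Fin n} (i<j : i Fin.< j) {x y : Fin m} (x≢y : x ≢ y) →
                     ¬ Balanced Γ (digon i<j x≢y)
  digon-unbalanced {i} {j} i<j {x} {y} x≢y bal = x≢y (x∙y⁻¹≈ε⇒x≈y x y (begin
    x ∙ (y ⁻¹)        ≡⟨ cong (x ∙_) (identityʳ _) ⟨
    x ∙ ((y ⁻¹) ∙ ε)  ≡⟨ cong₂ (λ a b → a ∙ (b ∙ ε)) (if-≡ {v = i} refl) (if-≢ (Fin.<⇒≢ i<j)) ⟨
    _                 ≡⟨ bal ⟩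
    ε                 ∎))
    where
    open ≡-Reasoning
    open GroupProperties (group Γ) using (x∙y⁻¹≈ε⇒x≈y)

  module _ {i j k : Fin n} (i<j : i Fin.< j) (j<k : j Fin.< k) (i<k : i Fin.< k) (x y : Fin m) where

    private
      i≢j : i ≢ j
      i≢j = Fin.<⇒≢ i<j
      j≢k : j ≢ k
      j≢k = Fin.<⇒≢ j<k
      i≢k : i ≢ k
      i≢k = Fin.<⇒≢ i<k
      e₀ e₁ e₂ : Edge n m
      e₀ = edge i j i<j x
      e₁ = edge j k j<k y
      e₂ = edge i k i<k (x ∙ y)

    triangle-e₀≢e₁ : e₀ ≢ e₁
    triangle-e₀≢e₁ eq = i≢j (cong Edge.i eq)
    triangle-e₀≢e₂ : e₀ ≢ e₂
    triangle-e₀≢e₂ eq = j≢k (cong Edge.j eq)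
    triangle-e₁≢e₂ : e₁ ≢ e₂
    triangle-e₁≢e₂ eq = i≢j (sym (cong Edge.i eq))

    triangle : Cycle n m
    triangle = record
      { len = 1
      ; vs = vs
      ; es = es
      ; vs-inj = λ { zero zero _ → refl
                   ; zero (suc zero) eq → contradiction eq i≢j
                   ; zero (suc (suc zero)) eq → contradiction eq i≢k
                   ; (suc zero) zero eq → contradiction (sym eq) i≢j
                   ; (suc zero) (suc zero) _ → refl
                   ; (suc zero) (suc (suc zero)) eq → contradiction eq j≢k
                   ; (suc (suc zero)) zero eq → contradiction (sym eq) i≢k
                   ; (suc (suc zero)) (suc zero) eq → contradiction (sym eq) j≢k
                   ; (suc (suc zero)) (suc (suc zero)) _ → refl }
      ; es-inj = λ { zero zero _ → refl
                   ; zero (suc zero) eq → contradiction eq triangle-e₀≢e₁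
                   ; zero (suc (suc zero)) eq → contradiction eq triangle-e₀≢e₂
                   ; (suc zero) zero eq → contradiction (sym eq) triangle-e₀≢e₁
                   ; (suc zero) (suc zero) _ → refl
                   ; (suc zero) (suc (suc zero)) eq → contradiction eq triangle-e₁≢e₂
                   ; (suc (suc zero)) zero eq → contradiction (sym eq) triangle-e₀≢e₂
                   ; (suc (suc zero)) (suc zero) eq → contradiction (sym eq) triangle-e₁≢e₂
                   ; (suc (suc zero)) (suc (suc zero)) _ → refl }
      ; joins = λ { zero → inj₁ (refl , refl) ; (suc zero) → inj₁ (refl , refl)
                  ; (suc (suc zero)) → inj₂ (refl , refl) }
      }
      where
      vs : Fin 3 → Fin n
      vs zero             = i
      vs (suc zero)       = j
      vs (suc (suc zero)) = k
      es : Fin 3 → Edge n m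
      es zero             = e₀
      es (suc zero)       = e₁
      es (suc (suc zero)) = e₂

    -- Only the third edge, from `k` back to `i`, is traversed against its orientation, and it
    -- contributes the inverse of `x ∙ y`.
    triangle-balanced : Balanced Γ triangle
    triangle-balanced = begin
      _ ≡⟨ cong₂ (λ a b → a ∙ b) (if-≡ {v = i} refl)
             (cong₂ (λ a b → a ∙ (b ∙ ε)) (if-≡ {v = j} refl) (if-≢ i≢k)) ⟩
      x ∙ (y ∙ (((x ∙ y) ⁻¹) ∙ ε)) ≡⟨ assoc _ _ _ ⟨
      (x ∙ y) ∙ (((x ∙ y) ⁻¹) ∙ ε) ≡⟨ cong ((x ∙ y) ∙_) (identityʳ _) ⟩
      (x ∙ y) ∙ ((x ∙ y) ⁻¹)       ≡⟨ inverseʳ _ ⟩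
      ε                            ∎
      where open ≡-Reasoning

-- Lines of a lift

module Framed (n : ℕ) (Γ : FinGroup)
  (MK : Matroid (Edge n (FinGroup.m Γ))) (cyc : IsCycleMatroid Γ n MK)
  (M : Matroid (Edge n (FinGroup.m Γ))) (lift : IsLift M MK)
  (bal : ∀ (C : Cycle n (FinGroup.m Γ)) → (Circuit M (CycleSet C) ⇔ Balanced Γ C)) where

  open FinGroup Γ
  open Span _≟ᴱ_ M public
  module SK = Span _≟ᴱ_ MK
  open Lift _≟ᴱ_ M MK
  open DecMembership (_≟ᴱ_ {n} {m}) using (_∈?_)
  open GroupProperties (group Γ) using (\\-leftDividesˡ; //-rightDividesˡ)

  private
    incident-∉ : ∀ {c : List (Edge n m)} {v e} → (∀ {f} → f ∈ c → ¬ Incident v f) → Incident v e → e ∉ c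
    incident-∉ v∉ v∈ e∈ = v∉ e∈ v∈

  SK-leaf : ∀ {c v e} → SK.I c → (∀ {f} → f ∈ c → ¬ Incident v f) → Incident v e → SK.I (e ∷ c)
  SK-leaf ic v∉ v∈ = from (cyc _) (leaf-acyclic Γ n (to (cyc _) ic) v∉ v∈)

  -- A basis `c` of `l` in the cycle matroid also avoids `v`, so `e` extends it there; `lift-extend`
  -- carries this over to `M`.
  leaf : ∀ {l} v {e} → (∀ {f} → f ∈ l → ¬ Incident v f) → Incident v e → Ind l → ¬ ¬ Ind (e ∷ l)
  leaf {l} v v∉ v∈ il ¬iel = SK.basis l λ (c , (uc , ic) , c⊆ , sp) →
    lift-extend lift il (SK-leaf ic (v∉ ∘ c⊆) v∈) uc (incident-∉ (v∉ ∘ c⊆) v∈) sp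
      λ iel → ¬iel (unique-∷ (incident-∉ v∉ v∈) (proj₁ il) , iel)

  -- Eliminates an auxiliary edge `e`: if `f ∷ l` stays independent after adding `e`, then `e`
  -- cannot have helped to span `f`.
  Cl-drop : ∀ {l e f} → Ind l → f ≢ e → (Ind (f ∷ l) → ¬ ¬ Ind (e ∷ f ∷ l)) →
            Cl (e ∷ l) f → Cl l f
  Cl-drop {l} {e} {f} il f≢e ext clf ifl = decidable-stable (f ∈? l) λ f∉ →
    ext (unique-∷ f∉ (proj₁ il) , ifl) λ (_ , iefl) →
      f∉ (drop (clf (I-⊆ (λ { (here eq) → there (here eq) ; (there (here eq)) → here eq
                            ; (there (there x∈)) → there (there x∈) }) iefl)))
    where
    drop : f ∈ (e ∷ l) → f ∈ l
    drop (here eq)  = contradiction eq f≢e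
    drop (there f∈) = f∈

  Cl-drop-leaf : ∀ {l} v {e f} → Ind l → (∀ {g} → g ∈ l → ¬ Incident v g) → Incident v e →
                 ¬ Incident v f → Cl (e ∷ l) f → Cl l f
  Cl-drop-leaf v il v∉l v∈e v∉f = Cl-drop il (λ { refl → v∉f v∈e })
    (leaf v (λ { (here refl) → v∉f ; (there g∈) → v∉l g∈ }) v∈e)

  module _ {i j : Fin n} (i<j : i Fin.< j) {x y : Fin m} (x≢y : x ≢ y) where

    parallel-unique : Unique (edge i j i<j x ∷ edge i j i<j y ∷ [])
    parallel-unique = ((λ eq → x≢y (cong Edge.lab eq)) ∷ []) ∷ [] ∷ []

    private
      digon⊆ : CycleSet (digon Γ n i<j x≢y) ⊆ (_∈ (edge i j i<j x ∷ edge i j i<j y ∷ []))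
      digon⊆ c with digon-pair Γ n i<j x≢y c
      ... | inj₁ refl = here refl
      ... | inj₂ refl = there (here refl)

    parallel-SK-dependent : ¬ SK.I (edge i j i<j x ∷ edge i j i<j y ∷ [])
    parallel-SK-dependent i = to (cyc _) i (digon Γ n i<j x≢y) digon⊆

    -- Proper subsets of the digon are acyclic, hence independent in `M`. Were the pair dependent,
    -- the digon would be a circuit and so balanced.
    parallel-Ind : ¬ ¬ Ind (edge i j i<j x ∷ edge i j i<j y ∷ [])
    parallel-Ind ¬i = digon-unbalanced Γ n i<j x≢y (to (bal (digon Γ n i<j x≢y))
      ( (λ i → ¬i (parallel-unique , indep-⊆ M (λ { (here refl) → zero , refl ; (there (here refl)) → suc zero , refl }) i))
      , λ D D⊆ ¬⊆D → lift-indep lift (from (cyc D) (digon-subset-acyclic Γ n i<j x≢y D D⊆ ¬⊆D))))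

  module Triangle {l} (il : Ind l) {i j k : Fin n}
                  (i<j : i Fin.< j) (j<k : j Fin.< k) (i<k : i Fin.< k) where

    private
      module _ (x y : Fin m) where
        e₀ = edge i j i<j x
        e₁ = edge j k j<k y
        e₂ = edge i k i<k (x ∙ y)
        T = triangle Γ n i<j j<k i<k x y

        e₀≢e₁ = triangle-e₀≢e₁ Γ n i<j j<k i<k x y
        e₀≢e₂ = triangle-e₀≢e₂ Γ n i<j j<k i<k x y
        e₁≢e₂ = triangle-e₁≢e₂ Γ n i<j j<k i<k x y

        circuit : Circuit M (CycleSet T)
        circuit = from (bal T) (triangle-balanced Γ n i<j j<k i<k x y)

        -- Two sides form a proper subset of a circuit, so they are independent and `Cl-trans`
        -- applies to the third side.
        close : ∀ {f g h} → CycleSet T f → CycleSet T g → CycleSet T h → f ≢ g → h ≢ f → h ≢ g →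
                (CycleSet T ⊆ (_∈ (h ∷ f ∷ g ∷ []))) → Cl l f → Cl l g → Cl l h
        close {f} {g} {h} Tf Tg Th f≢g h≢f h≢g T⊆ clf clg = Cl-trans il
          ( (f≢g ∷ []) ∷ [] ∷ []
          , proj₂ circuit (_∈ (f ∷ g ∷ []))
              (λ { (here refl) → Tf ; (there (here refl)) → Tg }) (λ ⊆D → h∉ (⊆D Th)))
          (λ { (here refl) → clf ; (there (here refl)) → clg })
          (λ i → proj₁ circuit (indep-⊆ M T⊆ i))
          where
          h∉ : h ∉ (f ∷ g ∷ [])
          h∉ (here eq)         = h≢f eq
          h∉ (there (here eq)) = h≢g eq

        close₂ : Cl l e₀ → Cl l e₁ → Cl l e₂
        close₂ = close (zero , refl) (suc zero , refl) (suc (suc zero) , refl)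
          e₀≢e₁ (e₀≢e₂ ∘ sym) (e₁≢e₂ ∘ sym)
          λ { (zero , refl) → there (here refl) ; (suc zero , refl) → there (there (here refl))
            ; (suc (suc zero) , refl) → here refl }

        close₁ : Cl l e₀ → Cl l e₂ → Cl l e₁
        close₁ = close (zero , refl) (suc (suc zero) , refl) (suc zero , refl)
          e₀≢e₂ (e₀≢e₁ ∘ sym) e₁≢e₂
          λ { (zero , refl) → there (here refl) ; (suc zero , refl) → here refl
            ; (suc (suc zero) , refl) → there (there (here refl)) }

        close₀ : Cl l e₁ → Cl l e₂ → Cl l e₀
        close₀ = close (suc zero , refl) (suc (suc zero) , refl) (zero , refl)
          e₁≢e₂ e₀≢e₁ e₀≢e₂
          λ { (zero , refl) → here refl ; (suc zero , refl) → there (here refl)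
            ; (suc (suc zero) , refl) → there (there (here refl)) }

    Cl-∙ : ∀ {x y} → Cl l (edge i j i<j x) → Cl l (edge j k j<k y) → Cl l (edge i k i<k (x ∙ y))
    Cl-∙ = close₂ _ _

    Cl-\\ : ∀ {x z} → Cl l (edge i j i<j x) → Cl l (edge i k i<k z) → Cl l (edge j k j<k ((x ⁻¹) ∙ z))
    Cl-\\ {x} {z} p q = close₁ _ _ p (subst (Cl l ∘ edge i k i<k) (sym (\\-leftDividesˡ x z)) q)

    Cl-// : ∀ {y z} → Cl l (edge j k j<k y) → Cl l (edge i k i<k z) → Cl l (edge i j i<j (z ∙ (y ⁻¹)))
    Cl-// {y} {z} p q = close₀ _ _ p (subst (Cl l ∘ edge i k i<k) (sym (//-rightDividesˡ y z)) q)

module Lines (k : ℕ) (Γ : FinGroup)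
  (MK : Matroid (Edge (4 + k) (FinGroup.m Γ))) (cyc : IsCycleMatroid Γ (4 + k) MK)
  (M : Matroid (Edge (4 + k) (FinGroup.m Γ))) (lift : IsLift M MK)
  (bal : ∀ (C : Cycle (4 + k) (FinGroup.m Γ)) → (Circuit M (CycleSet C) ⇔ Balanced Γ C)) where

  open FinGroup Γ
  open Framed (4 + k) Γ MK cyc M lift bal
  open Lift _≟ᴱ_ M MK
  open IsGroup isGroup using (identityˡ; identityʳ)
  open GroupProperties (group Γ) using (ε⁻¹≈ε; ⁻¹-involutive)

  private
    E = Edge (4 + k) m
    v₀ v₁ v₂ v₃ : Fin (4 + k)
    v₀ = zero
    v₁ = suc zero
    v₂ = suc (suc zero)
    v₃ = suc (suc (suc zero))

    0<1 : v₀ Fin.< v₁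
    0<1 = s≤s z≤n
    0<2 : v₀ Fin.< v₂
    0<2 = s≤s z≤n
    1<2 : v₁ Fin.< v₂
    1<2 = s≤s (s≤s z≤n)
    1<3 : v₁ Fin.< v₃
    1<3 = s≤s (s≤s z≤n)
    2<3 : v₂ Fin.< v₃
    2<3 = s≤s (s≤s (s≤s z≤n))

    e₀₁ e₁₂ e₂₃ : Fin m → E
    e₀₁ = edge v₀ v₁ 0<1
    e₁₂ = edge v₁ v₂ 1<2
    e₂₃ = edge v₂ v₃ 2<3

    module T₀₁₂ {l} (il : Ind l) = Triangle il 0<1 1<2 0<2
    module T₁₂₃ {l} (il : Ind l) = Triangle il 1<2 2<3 1<3

    base : Fin m → List E
    base α = e₀₁ ε ∷ e₀₁ α ∷ []

    base-Ind : ∀ {α} → α ≢ ε → ¬ ¬ Ind (base α)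
    base-Ind α≢ε = parallel-Ind 0<1 (α≢ε ∘ sym)

  -- The line through ε and α in the matroid induced on Γ by the edges joining
  -- the first two vertices.
  Line : Fin m → Fin m → Set
  Line α β = Cl (base α) (e₀₁ β)

  Line-stable : ∀ {α β} → Stable (Line α β)
  Line-stable {α} {β} = Cl-stable {base α} {e₀₁ β}

  Line-ε : ∀ {α} → Line α ε
  Line-ε _ = here refl

  Line-refl : ∀ {α} → Line α α
  Line-refl _ = there (here refl)

  -- Otherwise `e₀₁ z` and `base β` would be three independent edges in the closure of the two edges
  -- of `base α`.
  Line-switch : ∀ {α β z} → α ≢ ε → β ≢ ε → Line α β → Line α z → Line β z
  Line-switch {α} {β} {z} α≢ε β≢ε Lβ Lz i = decidable-stable (e₀₁ z ∈? base β) λ z∉ →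
    base-Ind α≢ε λ ib → ℕ.1+n≰n (span-length ib
      (unique-∷ z∉ (parallel-unique 0<1 (β≢ε ∘ sym)) , i)
      λ { (here refl) → Lz ; (there (here refl)) → Line-ε ; (there (there (here refl))) → Lβ })
    where open DecMembership (_≟ᴱ_ {4 + k} {m}) using (_∈?_)

  private
    v₂∉base : ∀ {α f} → f ∈ base α → ¬ Incident v₂ f
    v₂∉base (here refl)         (inj₁ ())
    v₂∉base (here refl)         (inj₂ ())
    v₂∉base (there (here refl)) (inj₁ ())
    v₂∉base (there (here refl)) (inj₂ ())

    v₃∉base : ∀ {α f} → f ∈ base α → ¬ Incident v₃ f
    v₃∉base (here refl)         (inj₁ ())
    v₃∉base (here refl)         (inj₂ ())
    v₃∉base (there (here refl)) (inj₁ ())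
    v₃∉base (there (here refl)) (inj₂ ())

  -- The flat spanned by e₀₁(ε), e₀₁(α) and e₁₂(ε) carries the same line on all
  -- three sides of the triangle.
  Line-// : ∀ {α x y} → α ≢ ε → Line α x → Line α y → Line α (x ∙ (y ⁻¹))
  Line-// {α} {x} {y} α≢ε Lx Ly = Line-stable λ ¬L →
    base-Ind α≢ε λ ib → leaf v₂ v₂∉base (inj₂ refl) ib λ il →
    let open T₀₁₂ il
        F-x = Cl-mono {base α} {e₁₂ ε ∷ base α} {e₀₁ x} there Lx
        F-y = Cl-mono {base α} {e₁₂ ε ∷ base α} {e₀₁ y} there Ly
        F-ε = Cl-∈ {e₁₂ ε ∷ base α} {e₀₁ ε} (there (here refl))
        F-12 = Cl-∈ {e₁₂ ε ∷ base α} {e₁₂ ε} (here refl)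
        -- `y` passes through side 02 to side 12, where it is divided out of the copy of `x` on side
        -- 02.
        y₁₂ = Cl-\\ F-ε (Cl-∙ F-y F-12)
        xy⁻¹ = Cl-// y₁₂ (Cl-∙ F-x F-12)
        simplify : (x ∙ ε) ∙ (((ε ⁻¹) ∙ (y ∙ ε)) ⁻¹) ≡ x ∙ (y ⁻¹)
        simplify = cong₂ (λ a b → a ∙ (b ⁻¹)) (identityʳ x)
          (trans (cong₂ _∙_ ε⁻¹≈ε (identityʳ y)) (identityˡ y))
    -- `e₁₂ ε` is the only edge at `v₂`, so the span of `base α` already suffices.
    in ¬L (Cl-drop-leaf v₂ ib v₂∉base (inj₂ refl) (λ { (inj₁ ()) ; (inj₂ ()) })
             (subst (Cl (e₁₂ ε ∷ base α) ∘ e₀₁) simplify xy⁻¹))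

  -- Transport along a path of three edges

  private
    data Side : E → Set where
      side₀₁ : ∀ x → Side (e₀₁ x)
      side₂₃ : ∀ x → Side (e₂₃ x)

    ¬side : ∀ {γ} → ¬ Side (e₁₂ γ)
    ¬side ()

    H : Fin m → List E
    H α = e₂₃ ε ∷ base α

    Side-H : ∀ {α f} → f ∈ H α → Side f
    Side-H (here refl)                 = side₂₃ _
    Side-H (there (here refl))         = side₀₁ _
    Side-H (there (there (here refl))) = side₀₁ _

    -- In the cycle matroid, `c` spans both end classes, and with the middle edge it forms a path.
    -- Thus the middle edge, whatever its label, raises the rank of any independent list of side
    -- edges.
    bridge : ∀ {γ l} → Ind l → (∀ {f} → f ∈ l → Side f) → ¬ ¬ Ind (e₁₂ γ ∷ l)
    bridge {γ} {l} il side ¬i =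
      lift-extend lift {c = c} il ic uc e∉c (λ f∈ → span (side f∈)) λ i →
        ¬i (unique-∷ (λ e∈ → ¬side (side e∈)) (proj₁ il) , i)
      where
      c = e₂₃ ε ∷ e₀₁ ε ∷ []

      e∉c : e₁₂ γ ∉ c
      e∉c (here ())
      e∉c (there (here ()))

      uc : Unique c
      uc = ((λ ()) ∷ []) ∷ [] ∷ []

      ic : SK.I (e₁₂ γ ∷ c)
      -- The path grows by leaves at `v₀`, `v₂` and `v₃`, and is then reordered.
      ic = SK.I-⊆ (λ { (here refl) → there (here refl) ; (there (here refl)) → here refl
                     ; (there (there (here refl))) → there (there (here refl)) })
        (SK-leaf {c = e₁₂ γ ∷ e₀₁ ε ∷ []} {v₃}
          (SK-leaf {c = e₀₁ ε ∷ []} {v₂}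
            (SK-leaf {c = []} {zero} (indep-⊆ MK (λ ()) (indep-∅ MK)) (λ ()) (inj₁ refl))
            (λ { (here refl) (inj₁ ()) ; (here refl) (inj₂ ()) }) (inj₂ refl))
          (λ { (here refl) (inj₁ ()) ; (here refl) (inj₂ ())
             ; (there (here refl)) (inj₁ ()) ; (there (here refl)) (inj₂ ()) }) (inj₂ refl))

      span : ∀ {f} → Side f → SK.Cl c f
      span (side₀₁ x) i with x Fin.≟ ε
      ... | yes refl = there (here refl)
      ... | no x≢ε   = contradiction (SK.I-⊆ (λ { (here refl) → here refl
              ; (there (here refl)) → there (there (here refl)) }) i) (parallel-SK-dependent 0<1 x≢ε)
      span (side₂₃ x) i with x Fin.≟ ε
      ... | yes refl = here refl
      ... | no x≢ε   = contradiction (SK.I-⊆ (λ { (here refl) → here refl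
              ; (there (here refl)) → there (here refl) }) i) (parallel-SK-dependent 2<3 x≢ε)

    -- Side edges spanned with the help of a bridge are spanned by `H α` alone, so bridges with
    -- different labels can be used in turn.
    Cl-drop-bridge : ∀ {α γ f} → Ind (H α) → Side f → Cl (e₁₂ γ ∷ H α) f → Cl (H α) f
    Cl-drop-bridge ih side = Cl-drop ih (λ { refl → ¬side side }) λ i →
      bridge i λ { (here refl) → side ; (there f∈) → Side-H f∈ }
    Line⇒conj₂₃ : ∀ {α β γ} → Ind (H α) → Line α β → Cl (H α) (e₂₃ ((γ ⁻¹) ∙ (β ∙ γ)))
    Line⇒conj₂₃ {α} {β} {γ} ih Lβ = Cl-stable {H α} λ ¬L → bridge ih Side-H λ iF →
      let module T = T₀₁₂ iF
          module U = T₁₂₃ iF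
          F = e₁₂ γ ∷ H α
          F-β = Cl-mono {base α} {F} {e₀₁ β} (there ∘ there) Lβ
          F-ε = Cl-∈ {F} {e₀₁ ε} (there (there (here refl)))
          F-γ = Cl-∈ {F} {e₁₂ γ} (here refl)
          F-23 = Cl-∈ {F} {e₂₃ ε} (there (here refl))
          -- `β` reaches side 12 as `β ∙ γ` by way of side 02 and keeps this label on side 13;
          -- dividing by the bridge label on the left gives the conjugate on side 23.
          βγ₁₂ = T.Cl-\\ F-ε (T.Cl-∙ F-β F-γ)
          conj = U.Cl-\\ F-γ (U.Cl-∙ βγ₁₂ F-23)
          simplify : (γ ⁻¹) ∙ (((ε ⁻¹) ∙ (β ∙ γ)) ∙ ε) ≡ (γ ⁻¹) ∙ (β ∙ γ)
          simplify = cong ((γ ⁻¹) ∙_) (trans (identityʳ _) (trans (cong (_∙ (β ∙ γ)) ε⁻¹≈ε) (identityˡ _)))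
      in ¬L (Cl-drop-bridge ih (side₂₃ _) (subst (Cl F ∘ e₂₃) simplify conj))

    -- The way back uses the bridge labelled `ε`, which leaves `η` unchanged. Then `e₁₂ ε` is
    -- removed as a bridge and `e₂₃ ε` as a leaf at `v₃`.
    23⇒Line : ∀ {α η} → Ind (base α) → Ind (H α) → Cl (H α) (e₂₃ η) → Line α η
    23⇒Line {α} {η} ib ih Hη = Line-stable {α} λ ¬L → bridge {ε} ih Side-H λ iF →
      let module T = T₀₁₂ iF
          module U = T₁₂₃ iF
          F = e₁₂ ε ∷ H α
          F-η = Cl-mono {H α} {F} {e₂₃ η} there Hη
          F-ε = Cl-∈ {F} {e₀₁ ε} (there (there (here refl)))
          F-12 = Cl-∈ {F} {e₁₂ ε} (here refl)
          F-23 = Cl-∈ {F} {e₂₃ ε} (there (here refl))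
          η₁₂ = U.Cl-// F-23 (U.Cl-∙ F-12 F-η)
          η₀₁ = T.Cl-// F-12 (T.Cl-∙ F-ε η₁₂)
          simplify : (ε ∙ ((ε ∙ η) ∙ (ε ⁻¹))) ∙ (ε ⁻¹) ≡ η
          simplify = trans (cong₂ _∙_ (trans (identityˡ _) (trans (cong₂ _∙_ (identityˡ η) ε⁻¹≈ε) (identityʳ η))) ε⁻¹≈ε)
                           (identityʳ η)
      in ¬L (Cl-drop-leaf v₃ ib v₃∉base (inj₂ refl) (λ { (inj₁ ()) ; (inj₂ ()) })
               (Cl-drop-bridge ih (side₀₁ _) (subst (Cl F ∘ e₀₁) simplify η₀₁)))

  -- Conjugation by γ carries the line on side 01 to the line on side 23 along
  -- the bridge e₁₂(γ); the span of e₀₁(ε), e₀₁(α), e₂₃(ε) does not depend on γ.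
  Line-conj : ∀ {α β} γ → α ≢ ε → Line α β → Line α ((γ ⁻¹) ∙ (β ∙ γ))
  Line-conj {α} γ α≢ε Lβ = Line-stable {α} λ ¬L → base-Ind α≢ε λ ib →
    leaf v₃ v₃∉base (inj₂ refl) ib λ ih → ¬L (23⇒Line ib ih (Line⇒conj₂₃ ih Lβ))

  -- Rank of `M` when a line is the whole group

  private
    spoke : Fin (3 + k) → Fin m → E
    spoke i = edge v₀ (suc i) (s≤s z≤n)

    spokes : List (Fin (3 + k)) → List E
    spokes = map (λ i → spoke i ε)

    -- A spanning tree; its length bounds the rank of the cycle matroid from below.
    star : List E
    star = spokes (allFin (3 + k))

    fan : Fin m → List (Fin (2 + k)) → List E
    fan α is = spokes (map suc is) ++ base α

    spokes-avoid : ∀ {i is f} → i ∉ is → f ∈ spokes is → ¬ Incident (suc i) f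
    spokes-avoid i∉ f∈ inc with ∈-map⁻ (λ i → spoke i ε) f∈ | inc
    ... | _ , j∈ , refl | inj₁ ()
    ... | _ , j∈ , refl | inj₂ refl = i∉ j∈

    spokes-SK : ∀ {is} → Unique is → SK.I (spokes is)
    spokes-SK {[]} _ = indep-⊆ MK (λ ()) (indep-∅ MK)
    spokes-SK {i ∷ is} (i≢ ∷ u) =
      SK-leaf (spokes-SK u) (spokes-avoid (λ i∈ → All.lookup i≢ i∈ refl)) (inj₂ refl)

    spoke-injective : ∀ {i j} → spoke i ε ≡ spoke j ε → i ≡ j
    spoke-injective refl = refl

    star-Ind : SK.Ind star
    star-Ind = Unique.map⁺ spoke-injective (Unique.allFin⁺ _) , spokes-SK (Unique.allFin⁺ _)

    length-spokes : ∀ is → length (spokes is) ≡ length is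
    length-spokes = length-map _

    length-allFin : ∀ j → length (allFin j) ≡ j
    length-allFin j = length-tabulate id

    fan-Ind : ∀ {α} → α ≢ ε → ∀ {is} → Unique is → ¬ ¬ Ind (fan α is)
    fan-Ind α≢ε {[]} _ = base-Ind α≢ε
    fan-Ind {α} α≢ε {i ∷ is} (i≢ ∷ u) ¬ind = fan-Ind α≢ε u λ ind →
      leaf (suc (suc i)) avoid (inj₂ refl) ind ¬ind
      where
      suc-i∉ : suc i ∉ map suc is
      suc-i∉ si∈ with ∈-map⁻ suc si∈
      ... | _ , i∈ , refl = All.lookup i≢ i∈ refl

      base-avoid : ∀ {f} → f ∈ base α → ¬ Incident (suc (suc i)) f
      base-avoid (here refl)         (inj₁ ())
      base-avoid (here refl)         (inj₂ ())
      base-avoid (there (here refl)) (inj₁ ())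
      base-avoid (there (here refl)) (inj₂ ())

      avoid : ∀ {f} → f ∈ fan α is → ¬ Incident (suc (suc i)) f
      avoid f∈ with ∈-++⁻ (spokes (map suc is)) f∈
      ... | inj₁ f∈s = spokes-avoid suc-i∉ f∈s
      ... | inj₂ f∈b = base-avoid f∈b

    -- The star with its first spoke replaced by the two edges of `base α`, hence one edge longer.
    wheel : Fin m → List E
    wheel α = fan α (allFin (2 + k))

    length-wheel : ∀ α → length (wheel α) ≡ 4 + k
    length-wheel α = begin
      length (wheel α)                                ≡⟨ length-++ (spokes (map suc (allFin (2 + k)))) ⟩
      length (spokes (map suc (allFin (2 + k)))) + 2  ≡⟨ cong (_+ 2) (length-spokes (map suc (allFin (2 + k)))) ⟩
      length (map suc (allFin (2 + k))) + 2           ≡⟨ cong (_+ 2) (length-map suc (allFin (2 + k))) ⟩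
      length (allFin (2 + k)) + 2                     ≡⟨ cong (_+ 2) (length-allFin (2 + k)) ⟩
      2 + k + 2                                       ≡⟨ ℕ.+-comm (2 + k) 2 ⟩
      4 + k                                           ∎
      where open ≡-Reasoning

    -- Once the parallel class 01 is spanned, triangles through `v₀` and `v₁` give all spokes, and
    -- triangles through `v₀` give the remaining edges.
    wheel-spans : ∀ {α} → Ind (wheel α) → (∀ β → Line α β) → ∀ e → Cl (wheel α) e
    wheel-spans {α} iw L = all
      where
      W = wheel α
      base⊆ : base α ⊆ₗ W
      base⊆ = ∈-++⁺ʳ (spokes (map suc (allFin (2 + k))))

      at₀₁ : ∀ x → Cl W (e₀₁ x)
      at₀₁ x = Cl-mono {base α} {W} {e₀₁ x} base⊆ (L x)

      at-ε : ∀ i → Cl W (spoke i ε)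
      at-ε zero    = at₀₁ ε
      at-ε (suc i) = Cl-∈ {W} {spoke (suc i) ε}
        (∈-++⁺ˡ (∈-map⁺ (λ i → spoke i ε) (∈-map⁺ suc (∈-allFin i))))

      at-spoke : ∀ i x → Cl W (spoke i x)
      at-spoke zero    x = at₀₁ x
      -- Label `x ⁻¹` on side 01 and the spoke labelled `ε` put `x` on the third side; label `ε` on
      -- side 01 then moves it to the spoke.
      at-spoke (suc i) x = subst (Cl W ∘ spoke (suc i)) simplify
        (Cl-∙ (at₀₁ ε) (Cl-\\ (at₀₁ (x ⁻¹)) (at-ε (suc i))))
        where
        open Triangle iw 0<1 (s≤s (s≤s z≤n)) (s≤s z≤n)
        simplify : ε ∙ (((x ⁻¹) ⁻¹) ∙ ε) ≡ x
        simplify = trans (identityˡ _) (trans (identityʳ _) (⁻¹-involutive x))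

      all : ∀ e → Cl W e
      all (edge zero    (suc j) (s≤s z≤n) x) = at-spoke j x
      all (edge (suc i) (suc j) i<j       x) = subst (Cl W ∘ edge (suc i) (suc j) i<j)
        (trans (cong (_∙ x) ε⁻¹≈ε) (identityˡ x))
        (Cl-\\ (at-ε i) (at-spoke j x))
        where open Triangle iw {i = zero} (s≤s z≤n) i<j (s≤s z≤n)

  -- If a line were everything, the wheel would span `M`, so the rank of `M` would exceed the length
  -- of the star, and hence the rank of the cycle matroid, by at most one.
  Line-proper : (∃[ a ] ∃[ b ] (IsRankOf M a × IsRankOf MK b × b + 1 < a)) →
                ∀ {α} → α ≢ ε → ¬ (∀ β → Line α β)
  Line-proper (a , b , ((X , _ , iX , (l , ul , X⇔l , len)) , _) , (_ , maxMK) , lt) {α} α≢ε L =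
    fan-Ind α≢ε (Unique.allFin⁺ (2 + k)) λ iw → ℕ.<⇒≱ lt (begin
      a                ≡⟨ len ⟨
      length l         ≤⟨ span-length iw (ul , indep-⊆ M (λ {e} → from (X⇔l e)) iX)
                            (λ {e} _ → wheel-spans iw L e) ⟩
      length (wheel α) ≡⟨ length-wheel α ⟩
      suc (3 + k)      ≡⟨ cong suc (trans (length-spokes (allFin (3 + k))) (length-allFin (3 + k))) ⟨
      suc (length star) ≤⟨ s≤s (maxMK (_∈ star) (length star) _ (proj₂ star-Ind)
                            (SK.hasCard (proj₁ star-Ind))) ⟩
      suc b            ≡⟨ ℕ.+-comm 1 b ⟩
      b + 1            ∎)
    where open ℕ.≤-Reasoning

-- Groups partitioned into normal subgroups

-- The subgroups Line α, α ≠ ε, with ε removed, are the parts of a partition of Γ ∖ {ε}.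
record NormalPartition (Γ : FinGroup) : Set₁ where
  open FinGroup Γ
  field
    Line        : Fin m → Fin m → Set
    Line-stable : ∀ {α β} → Stable (Line α β)
    Line-ε      : ∀ {α} → Line α ε
    Line-refl   : ∀ {α} → Line α α
    Line-//     : ∀ {α x y} → α ≢ ε → Line α x → Line α y → Line α (x ∙ (y ⁻¹))
    Line-conj   : ∀ {α β} γ → α ≢ ε → Line α β → Line α ((γ ⁻¹) ∙ (β ∙ γ))
    Line-switch : ∀ {α β z} → α ≢ ε → β ≢ ε → Line α β → Line α z → Line β z
    Line-proper : ∀ {α} → α ≢ ε → ¬ (∀ β → Line α β)

Commutative : FinGroup → Set
Commutative Γ = ∀ x y → x ∙ y ≡ y ∙ x
  where open FinGroup Γ

commutativeMonoid : (Γ : FinGroup) → Commutative Γ → CommutativeMonoid 0ℓ 0ℓ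
commutativeMonoid Γ comm = record { isCommutativeMonoid = record
  { isMonoid = IsGroup.isMonoid (FinGroup.isGroup Γ) ; comm = comm } }

module Mult (Γ : FinGroup) where
  open MonoidMult (Group.monoid (group Γ)) public renaming (_×_ to _·_)

  open FinGroup Γ

  ·-ε : ∀ k → k · ε ≡ ε
  ·-ε zero    = refl
  ·-ε (suc k) = trans (IsGroup.identityˡ isGroup _) (·-ε k)

module PartitionProperties (Γ : FinGroup) (P : NormalPartition Γ) where
  open FinGroup Γ
  open NormalPartition P
  open IsGroup isGroup using (assoc; identityˡ; identityʳ)
  open GroupProperties (group Γ)
  open Mult Γ

  Line-⁻¹ : ∀ {α x} → α ≢ ε → Line α x → Line α (x ⁻¹)
  Line-⁻¹ {α} {x} α≢ε Lx = subst (Line α) (identityˡ (x ⁻¹)) (Line-// α≢ε Line-ε Lx)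

  Line-∙ : ∀ {α x y} → α ≢ ε → Line α x → Line α y → Line α (x ∙ y)
  Line-∙ {α} {x} {y} α≢ε Lx Ly =
    subst (λ z → Line α (x ∙ z)) (⁻¹-involutive y) (Line-// α≢ε Lx (Line-⁻¹ α≢ε Ly))

  Line-· : ∀ {α x} k → α ≢ ε → Line α x → Line α (k · x)
  Line-· zero    α≢ε Lx = Line-ε
  Line-· (suc k) α≢ε Lx = Line-∙ α≢ε Lx (Line-· k α≢ε Lx)

  Line-sym : ∀ {α β} → α ≢ ε → β ≢ ε → Line α β → Line β α
  Line-sym α≢ε β≢ε L = Line-switch α≢ε β≢ε L Line-refl

  Line-trans : ∀ {α β z} → α ≢ ε → β ≢ ε → Line α β → Line β z → Line α z
  Line-trans α≢ε β≢ε Lβ Lz = Line-switch β≢ε α≢ε (Line-sym α≢ε β≢ε Lβ) Lz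

  off-line-≢ε : ∀ {α β} → ¬ Line α β → β ≢ ε
  off-line-≢ε ¬L refl = ¬L Line-ε

  -- Properness only excludes that every element is on the line; an element off it is available when
  -- the goal is stable.
  choose-off-line : ∀ {α} {A : Set} → Stable A → α ≢ ε → (∀ z → ¬ Line α z → A) → A
  choose-off-line st α≢ε f = st λ ¬a → Line-proper α≢ε λ z → Line-stable λ ¬L → ¬a (f z ¬L)

  -- Normality puts the commutator x⁻¹y⁻¹xy in both Line x and Line y.
  off-line-comm : ∀ {x y} → x ≢ ε → ¬ Line x y → x ∙ y ≡ y ∙ x
  off-line-comm {x} {y} x≢ε ¬L with ((x ⁻¹) ∙ ((y ⁻¹) ∙ (x ∙ y))) Fin.≟ ε
  ... | yes c≡ε = begin
    x ∙ y                      ≡⟨ \\-leftDividesˡ y (x ∙ y) ⟨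
    y ∙ ((y ⁻¹) ∙ (x ∙ y))     ≡⟨ cong (y ∙_) (trans (inverseʳ-unique (x ⁻¹) _ c≡ε) (⁻¹-involutive x)) ⟩
    y ∙ x                      ∎
    where open ≡-Reasoning
  ... | no c≢ε = contradiction (Line-trans x≢ε c≢ε in-x (Line-sym y≢ε c≢ε in-y)) ¬L
    where
    y≢ε = off-line-≢ε ¬L
    in-x : Line x ((x ⁻¹) ∙ ((y ⁻¹) ∙ (x ∙ y)))
    in-x = Line-∙ x≢ε (Line-⁻¹ x≢ε Line-refl) (Line-conj y x≢ε Line-refl)
    in-y : Line y ((x ⁻¹) ∙ ((y ⁻¹) ∙ (x ∙ y)))
    in-y = subst (Line y) (trans (assoc _ _ _) (cong ((x ⁻¹) ∙_) (assoc _ _ _)))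
      (Line-∙ y≢ε (Line-conj x y≢ε (Line-⁻¹ y≢ε Line-refl)) Line-refl)

  -- On a common line, y commutes with z and with x z for any z off the line.
  on-line-comm : ∀ {x y} → x ≢ ε → y ≢ ε → Line x y → x ∙ y ≡ y ∙ x
  on-line-comm {x} {y} x≢ε y≢ε L =
    choose-off-line (decidable-stable (_ Fin.≟ _)) x≢ε λ z ¬Lz →
    let L' = Line-sym x≢ε y≢ε L
        ¬Lyz : ¬ Line y z
        ¬Lyz l = ¬Lz (Line-trans x≢ε y≢ε L l)
        ¬Lyxz : ¬ Line y (x ∙ z)
        ¬Lyxz l = ¬Lyz (subst (Line y) (\\-leftDividesʳ x z) (Line-∙ y≢ε (Line-⁻¹ y≢ε L') l))
    in ∙-cancelʳ z (x ∙ y) (y ∙ x) (begin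
      (x ∙ y) ∙ z ≡⟨ assoc x y z ⟩
      x ∙ (y ∙ z) ≡⟨ cong (x ∙_) (off-line-comm y≢ε ¬Lyz) ⟩
      x ∙ (z ∙ y) ≡⟨ assoc x z y ⟨
      (x ∙ z) ∙ y ≡⟨ off-line-comm y≢ε ¬Lyxz ⟨
      y ∙ (x ∙ z) ≡⟨ assoc y x z ⟨
      (y ∙ x) ∙ z ∎)
    where open ≡-Reasoning

  comm : Commutative Γ
  comm x y with x Fin.≟ ε | y Fin.≟ ε
  ... | yes refl | _        = trans (identityˡ y) (sym (identityʳ y))
  ... | _        | yes refl = trans (identityʳ x) (sym (identityˡ x))
  -- Membership in a line is not decided, but equality in the group is, so both cases are tried
  -- under a negation.
  ... | no x≢ε   | no y≢ε   = decidable-stable (_ Fin.≟ _) λ ¬c →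
    ¬c (off-line-comm x≢ε λ L → ¬c (on-line-comm x≢ε y≢ε L))

  open CommutativeMonoidMult (commutativeMonoid Γ comm) using (×-distrib-+)

  -- Since `k · (α ∙ y)` equals `k · y`, a value other than `ε` would lie on the lines of both `y`
  -- and `α ∙ y`. These would coincide and contain `α`.
  off-line-torsion : ∀ {α y} k → α ≢ ε → k · α ≡ ε → ¬ Line α y → k · y ≡ ε
  off-line-torsion {α} {y} k α≢ε kα≡ε ¬L with (k · y) Fin.≟ ε
  ... | yes p  = p
  ... | no w≢ε = contradiction (Line-sym y≢ε α≢ε (subst (Line y) (//-rightDividesʳ y α)
                   (Line-// y≢ε Ly-αy Line-refl))) ¬L
    where
    y≢ε = off-line-≢ε ¬L
    αy≢ε : (α ∙ y) ≢ ε
    αy≢ε eq = ¬L (subst (Line α) (sym (inverseʳ-unique α y eq)) (Line-⁻¹ α≢ε Line-refl))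
    k·αy : k · (α ∙ y) ≡ k · y
    k·αy = trans (×-distrib-+ α y k) (trans (cong (_∙ (k · y)) kα≡ε) (identityˡ _))
    Ly-αy : Line y (α ∙ y)
    Ly-αy = Line-trans y≢ε w≢ε (Line-· k y≢ε Line-refl)
      (Line-sym αy≢ε w≢ε (subst (Line (α ∙ y)) k·αy (Line-· k αy≢ε Line-refl)))

  -- Elements off the line of `α` are reached directly, those on it through some `w` off the line.
  uniform-torsion : ∀ {α} k → α ≢ ε → k · α ≡ ε → ∀ y → k · y ≡ ε
  uniform-torsion {α} k α≢ε kα≡ε y = decidable-stable (_ Fin.≟ _) λ ky≢ε →
    ky≢ε (off-line-torsion k α≢ε kα≡ε λ Ly → ky≢ε (on-line Ly))
    where
    on-line : Line α y → k · y ≡ ε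
    on-line Ly = choose-off-line (decidable-stable (_ Fin.≟ _)) α≢ε λ w ¬Lw → via w ¬Lw (y Fin.≟ ε)
      where
      via : ∀ w → ¬ Line α w → Dec (y ≡ ε) → k · y ≡ ε
      via w ¬Lw (no y≢ε)   = off-line-torsion k w≢ε (off-line-torsion k α≢ε kα≡ε ¬Lw)
        λ Lwy → ¬Lw (Line-trans α≢ε y≢ε Ly (Line-sym w≢ε y≢ε Lwy))
        where w≢ε = off-line-≢ε ¬Lw
      via w ¬Lw (yes refl) = ·-ε k

  not-cyclic : ∀ {α} → α ≢ ε → ¬ (∀ y → ∃ λ k → k · α ≡ y)
  not-cyclic α≢ε gen = Line-proper α≢ε λ y →
    let k , eq = gen y in subst (Line _) eq (Line-· k α≢ε Line-refl)

-- Elementary abelian groups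

module Torsion (Γ : FinGroup) where
  open FinGroup Γ
  open IsGroup isGroup using (identityʳ)
  open GroupProperties (group Γ) using (identityʳ-unique)
  open Mult Γ

  -- Among `m + 1` multiples of `α` two coincide, and their difference is a positive multiple equal
  -- to `ε`.
  finite-order : ∀ α → ∃ λ k → suc k · α ≡ ε
  finite-order α with i , j , i<j , eq ← Fin.pigeonhole (ℕ.n<1+n m) (λ i → toℕ i · α)
    with k , j≡ ← ℕ.m≤n⇒∃[o]m+o≡n i<j
    = k , identityʳ-unique (toℕ i · α) _ (begin
      (toℕ i · α) ∙ (suc k · α)  ≡⟨ ×-homo-+ α (toℕ i) (suc k) ⟨
      (toℕ i + suc k) · α        ≡⟨ cong (_· α) (trans (ℕ.+-suc (toℕ i) k) j≡) ⟩
      toℕ j · α                  ≡⟨ eq ⟨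
      toℕ i · α                  ∎)
    where open ≡-Reasoning

  -- Prime factors of an annihilating multiple are stripped off until the remaining multiple of `α`
  -- is no longer `ε`.
  prime-torsion : ∀ {α} → α ≢ ε → ∃ λ p → ∃ λ β → Prime p × β ≢ ε × p · β ≡ ε
  prime-torsion {α} α≢ε with k , kα≡ε ← finite-order α =
    go factors factorsPrime (trans (cong (_· α) (sym isFactorisation)) kα≡ε)
    where
    open PrimeFactorisation (factorise (suc k))
    go : ∀ ps → All Prime ps → product ps · α ≡ ε → ∃ λ p → ∃ λ β → Prime p × β ≢ ε × p · β ≡ ε
    go [] [] eq = contradiction (trans (sym (identityʳ α)) eq) α≢ε
    go (p ∷ ps) (pp ∷ pps) eq with (product ps · α) Fin.≟ ε
    ... | yes eq' = go ps pps eq'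
    ... | no ≢ε   = p , product ps · α , pp , ≢ε , trans (×-assocˡ α p (product ps)) eq

-- Coordinates over the prime field

any-Vec? : ∀ {k j} {P : Vec (Fin k) j → Set} → Decidable P → Dec (∃ P)
any-Vec? {j = zero}  P? = map′ ([] ,_) (λ { ([] , p) → p }) (P? [])
any-Vec? {j = suc j} P? = map′ (λ (a , v , p) → a ∷ v , p) (λ { (a ∷ v , p) → a , v , p })
  (Fin.any? λ a → any-Vec? λ v → P? (a ∷ v))

module ElementaryAbelian (Γ : FinGroup) (comm : Commutative Γ)
  (p-1 : ℕ) (prime : Prime (suc p-1)) (torsion : ∀ y → Mult._·_ Γ (suc p-1) y ≡ FinGroup.ε Γ) where

  open FinGroup Γ
  open Mult Γ

  private p = suc p-1

  open IsGroup isGroup using (assoc; identityˡ; identityʳ)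
  open GroupProperties (group Γ)

  open CommutativeSemigroupProperties (CommutativeMonoid.commutativeSemigroup (commutativeMonoid Γ comm))
    using (interchange)

  ·-multiple : ∀ x q → (q * p) · x ≡ ε
  ·-multiple x q = begin
    (q * p) · x ≡⟨ cong (_· x) (ℕ.*-comm q p) ⟩
    (p * q) · x ≡⟨ ×-assocˡ x p q ⟨
    p · (q · x) ≡⟨ torsion _ ⟩
    ε           ∎
    where open ≡-Reasoning

  ·-addMod : ∀ x (a b : Fin p) → toℕ (addMod a b) · x ≡ (toℕ a · x) ∙ (toℕ b · x)
  ·-addMod x a b = begin
    toℕ (addMod a b) · x                  ≡⟨ cong (_· x) (Fin.toℕ-fromℕ< (m%n<n s p)) ⟩
    (s % p) · x                           ≡⟨ identityʳ _ ⟨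
    ((s % p) · x) ∙ ε                     ≡⟨ cong (((s % p) · x) ∙_) (·-multiple x (s / p)) ⟨
    ((s % p) · x) ∙ ((s / p * p) · x)     ≡⟨ ×-homo-+ x (s % p) (s / p * p) ⟨
    (s % p + s / p * p) · x               ≡⟨ cong (_· x) (m≡m%n+[m/n]*n s p) ⟨
    s · x                                 ≡⟨ ×-homo-+ x (toℕ a) (toℕ b) ⟩
    (toℕ a · x) ∙ (toℕ b · x)             ∎
    where
    open ≡-Reasoning
    s = toℕ a + toℕ b

  -- Linear combinations with coefficients in the prime field: injectivity means that `bs` is
  -- linearly independent, and `Image` is its span.
  ⟦_⟧ : ∀ {j} → Vec (Fin m) j → Vec (Fin p) j → Fin m
  ⟦ [] ⟧     []      = ε
  ⟦ b ∷ bs ⟧ (a ∷ v) = (toℕ a · b) ∙ ⟦ bs ⟧ v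

  ⟦⟧-⊕ : ∀ {j} (bs : Vec (Fin m) j) v w → ⟦ bs ⟧ (v ⊕ w) ≡ ⟦ bs ⟧ v ∙ ⟦ bs ⟧ w
  ⟦⟧-⊕ []       []      []      = sym (identityˡ ε)
  ⟦⟧-⊕ (b ∷ bs) (x ∷ v) (y ∷ w) =
    trans (cong₂ _∙_ (·-addMod b x y) (⟦⟧-⊕ bs v w)) (interchange _ _ _ _)

  Image : ∀ {j} → Vec (Fin m) j → Fin m → Set
  Image bs g = ∃ λ v → ⟦ bs ⟧ v ≡ g

  module _ {j} (bs : Vec (Fin m) j) where

    image? : Decidable (Image bs)
    image? g = any-Vec? λ v → ⟦ bs ⟧ v Fin.≟ g

    image-∙ : ∀ {g h} → Image bs g → Image bs h → Image bs (g ∙ h)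
    image-∙ (v , refl) (w , refl) = v ⊕ w , ⟦⟧-⊕ bs v w

  image-ε : ∀ {j} (bs : Vec (Fin m) j) → Image bs ε
  image-ε []       = [] , refl
  image-ε (b ∷ bs) with v , eq ← image-ε bs = zero ∷ v , trans (identityˡ _) eq

  module _ {j} (bs : Vec (Fin m) j) where

    image-· : ∀ {g} k → Image bs g → Image bs (k · g)
    image-· zero    im = image-ε bs
    image-· (suc k) im = image-∙ bs im (image-· k im)

    image-⁻¹ : ∀ {g} → Image bs g → Image bs (g ⁻¹)
    -- By torsion, the inverse of `g` is `p-1 · g`.
    image-⁻¹ {g} im = subst (Image bs) (inverseʳ-unique g (p-1 · g) (torsion g)) (image-· p-1 im)

    -- `d` is invertible modulo the prime; the two signs in the Bézout identity give `y` or its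
    -- inverse as a multiple of `d · y`.
    image-divide : ∀ {d y} → 0 < d → d < p → Image bs (d · y) → Image bs y
    image-divide {suc d'} {y} _ d<p im with coprime-Bézout (prime⇒coprime prime d<p)
    ... | Bézout.+- x z eq = subst (Image bs) inv (image-⁻¹ (image-· z im))
      where
      open ≡-Reasoning
      d = suc d'
      inv : (z · (d · y)) ⁻¹ ≡ y
      inv = sym (inverseˡ-unique y (z · (d · y)) (begin
        y ∙ (z · (d · y)) ≡⟨ cong (y ∙_) (×-assocˡ y z d) ⟩
        (1 + z * d) · y   ≡⟨ cong (_· y) eq ⟩
        (x * p) · y       ≡⟨ ·-multiple y x ⟩
        ε                 ∎))
    ... | Bézout.-+ x z eq = subst (Image bs) inv (image-· z im)
      where
      open ≡-Reasoning
      d = suc d'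
      inv : z · (d · y) ≡ y
      inv = begin
        z · (d · y)         ≡⟨ ×-assocˡ y z d ⟩
        (z * d) · y         ≡⟨ cong (_· y) eq ⟨
        y ∙ ((x * p) · y)   ≡⟨ cong (y ∙_) (·-multiple y x) ⟩
        y ∙ ε               ≡⟨ identityʳ y ⟩
        y                   ∎

    -- Subtracting the two combinations leaves a multiple of `y` by a scalar strictly between 0 and
    -- `p`, which can be divided out.
    difference-in-image : ∀ {y} {a b : Fin p} {v w} → toℕ a < toℕ b →
      (toℕ a · y) ∙ ⟦ bs ⟧ v ≡ (toℕ b · y) ∙ ⟦ bs ⟧ w → Image bs y
    difference-in-image {y} {a} {b} {v} {w} a<b eq with k , b≡ ← ℕ.m≤n⇒∃[o]m+o≡n a<b =
      image-divide (s≤s z≤n) k<p (subst (Image bs) ky (image-∙ bs (v , refl) (image-⁻¹ (w , refl))))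
      where
      open ≡-Reasoning
      a+k≡b : toℕ a + suc k ≡ toℕ b
      a+k≡b = trans (ℕ.+-suc (toℕ a) k) b≡
      k<p : suc k < p
      k<p = ℕ.≤-<-trans (subst (suc k ≤_) a+k≡b (ℕ.m≤n+m (suc k) (toℕ a))) (Fin.toℕ<n b)
      v≡ : ⟦ bs ⟧ v ≡ (suc k · y) ∙ ⟦ bs ⟧ w
      v≡ = ∙-cancelˡ (toℕ a · y) _ _ (begin
        (toℕ a · y) ∙ ⟦ bs ⟧ v                   ≡⟨ eq ⟩
        (toℕ b · y) ∙ ⟦ bs ⟧ w                   ≡⟨ cong (λ c → (c · y) ∙ ⟦ bs ⟧ w) a+k≡b ⟨
        ((toℕ a + suc k) · y) ∙ ⟦ bs ⟧ w         ≡⟨ cong (_∙ ⟦ bs ⟧ w) (×-homo-+ y (toℕ a) (suc k)) ⟩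
        ((toℕ a · y) ∙ (suc k · y)) ∙ ⟦ bs ⟧ w   ≡⟨ assoc _ _ _ ⟩
        (toℕ a · y) ∙ ((suc k · y) ∙ ⟦ bs ⟧ w)   ∎)
      ky : ⟦ bs ⟧ v ∙ ((⟦ bs ⟧ w) ⁻¹) ≡ suc k · y
      ky = trans (cong (_∙ ((⟦ bs ⟧ w) ⁻¹)) v≡) (//-rightDividesʳ (⟦ bs ⟧ w) (suc k · y))

    adjoin-injective : ∀ {y} → Injective _≡_ _≡_ ⟦ bs ⟧ → ¬ Image bs y → Injective _≡_ _≡_ ⟦ y ∷ bs ⟧
    adjoin-injective {y} inj y∉ {a ∷ v} {b ∷ w} eq with ℕ.<-cmp (toℕ a) (toℕ b)
    ... | tri< a<b _ _ = contradiction (difference-in-image {v = v} {w} a<b eq) y∉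
    ... | tri> _ _ b<a = contradiction (difference-in-image {v = w} {v} b<a (sym eq)) y∉
    ... | tri≈ _ a≡b _ with refl ← Fin.toℕ-injective a≡b =
      cong (a ∷_) (inj (∙-cancelˡ (toℕ a · y) _ _ eq))

  1<p : 1 < p
  1<p = nonTrivial⇒n>1 p {{prime⇒nonTrivial prime}}

  image-adjoined : ∀ {j} (bs : Vec (Fin m) j) y → Image (y ∷ bs) y
  image-adjoined bs y with v , eq ← image-ε bs =
    Fin.fromℕ< 1<p ∷ v , trans (cong₂ (λ a b → (a · y) ∙ b) (Fin.toℕ-fromℕ< 1<p) eq)
                            (trans (identityʳ _) (identityʳ y))

  image-mono : ∀ {j} (bs : Vec (Fin m) j) y {g} → Image bs g → Image (y ∷ bs) g
  image-mono bs y (v , eq) = zero ∷ v , trans (identityˡ _) eq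

  -- A basis is chosen greedily; finitely many coefficient vectors make membership in a span
  -- decidable.
  independent-spanning : ∀ gs → ∃ λ j → ∃ λ (bs : Vec (Fin m) j) →
    Injective _≡_ _≡_ ⟦ bs ⟧ × (∀ {g} → g ∈ gs → Image bs g)
  independent-spanning [] = 0 , [] , (λ { {[]} {[]} _ → refl }) , λ ()
  independent-spanning (g ∷ gs) with j , bs , inj , sp ← independent-spanning gs | image? bs g
  ... | yes g∈ = j , bs , inj , λ { (here refl) → g∈ ; (there h∈) → sp h∈ }
  ... | no g∉  = suc j , g ∷ bs , adjoin-injective bs inj g∉
    , λ { (here refl) → image-adjoined bs g ; (there h∈) → image-mono bs g (sp h∈) }

  -- Coordinates invert an additive bijection, so they are additive too.
  coordinates : ∃ λ j → (Γ ≅Zp^ p) j × ∃ λ (bs : Vec (Fin m) j) → ∀ g → Image bs g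
  coordinates with j , bs , inj , sp ← independent-spanning (allFin m) =
    j , (coord , (coord-injective , λ v → ⟦ bs ⟧ v , λ { refl → inj (⟦coord⟧ _) }) , hom) , bs , spans
    where
    spans : ∀ g → Image bs g
    spans g = sp (∈-allFin g)
    coord : Fin m → Vec (Fin p) j
    coord g = proj₁ (spans g)
    ⟦coord⟧ : ∀ g → ⟦ bs ⟧ (coord g) ≡ g
    ⟦coord⟧ g = proj₂ (spans g)
    coord-injective : Injective _≡_ _≡_ coord
    coord-injective {g} {h} eq = trans (sym (⟦coord⟧ g)) (trans (cong ⟦ bs ⟧ eq) (⟦coord⟧ h))
    hom : ∀ x y → coord (x ∙ y) ≡ coord x ⊕ coord y
    hom x y = inj (trans (⟦coord⟧ (x ∙ y)) (sym
      (trans (⟦⟧-⊕ bs (coord x) (coord y)) (cong₂ _∙_ (⟦coord⟧ x) (⟦coord⟧ y)))))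

  -- Dimension 0 would make the group trivial, and dimension 1 would make it cyclic.
  rank≥2 : ∀ {α} → α ≢ ε → (∀ {β} → β ≢ ε → ¬ (∀ y → ∃ λ k → k · β ≡ y)) →
           ∀ {j} (bs : Vec (Fin m) j) → (∀ g → Image bs g) → 2 ≤ j
  rank≥2 {α} α≢ε nc [] sp with [] , eq ← sp α = contradiction (sym eq) α≢ε
  rank≥2 {α} α≢ε nc (b ∷ []) sp = contradiction generates (nc b≢ε)
    where
    generates : ∀ y → ∃ λ k → k · b ≡ y
    generates y with (a ∷ []) , eq ← sp y = toℕ a , trans (sym (identityʳ _)) eq
    b≢ε : b ≢ ε
    b≢ε refl with k , eq ← generates α = α≢ε (trans (sym eq) (·-ε k))
  rank≥2 α≢ε nc (_ ∷ _ ∷ _) sp = s≤s (s≤s z≤n)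

elementary-abelian : (Γ : FinGroup) → (∃[ x ] (x ≢ FinGroup.ε Γ)) → NormalPartition Γ →
                     ∃[ p ] ∃[ j ] (Prime p × 2 ≤ j × (Γ ≅Zp^ p) j)
elementary-abelian Γ (α , α≢ε) P with Torsion.prime-torsion Γ α≢ε
... | zero , _ , p-prime , _ = contradiction p-prime ¬prime[0]
... | suc p-1 , β , p-prime , β≢ε , pβ≡ε =
  let open PartitionProperties Γ P
      open ElementaryAbelian Γ comm p-1 p-prime (uniform-torsion (suc p-1) β≢ε pβ≡ε)
      j , iso , bs , spans = coordinates
  in suc p-1 , j , p-prime , rank≥2 α≢ε not-cyclic bs spans , iso

theorem4p1 : (n : ℕ) → 4 ≤ n → (Γ : FinGroup) →
    (∃[ x ] (x ≢ FinGroup.ε Γ)) →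
    (MK : Matroid (Edge n (FinGroup.m Γ))) → IsCycleMatroid Γ n MK →
    (M : Matroid (Edge n (FinGroup.m Γ))) → IsLift M MK →
    (∀ (C : Cycle n (FinGroup.m Γ)) → (Circuit M (CycleSet C) ⇔ Balanced Γ C)) →
    (∃[ a ] ∃[ b ] (IsRankOf M a × IsRankOf MK b × b + 1 < a)) →
    ∃[ p ] ∃[ j ] (Prime p × 2 ≤ j × (Γ ≅Zp^ p) j)
theorem4p1 (suc (suc (suc (suc k)))) (s≤s (s≤s (s≤s (s≤s z≤n)))) Γ nontrivial MK cyc M lift bal rank =
  elementary-abelian Γ nontrivial record
    { Line        = Line
    ; Line-stable = λ {α} {β} → Line-stable {α} {β}
    ; Line-ε      = λ {α} → Line-ε {α}
    ; Line-refl   = λ {α} → Line-refl {α}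
    ; Line-//     = Line-//
    ; Line-conj   = Line-conj
    ; Line-switch = Line-switch
    ; Line-proper = Line-proper rank
    }
  where open Lines k Γ MK cyc M lift bal
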